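{- Let $k\ge1$. If a chord diagram $C$ is $k$-terminal and has at least $k+1$ chords, then $C$ is $k$-connected.
   Context: A chord diagram of size $n$ is a perfect matching of $\{1,\dots,2n\}$; chords are ordered pairs $(a,b)$ with $a<b$, $a$ the source and $b$ the sink. For chords $c_1=(a_1,b_1)$, $c_2=(a_2,b_2)$ with $a_1<a_2$, they cross if $a_2<b_1<b_2$, and then $c_2$ is a right neighbor of $c_1$. The intersection graph has chords as vertices and crossings as edges. A chord is $j$-terminal if it has at most $j-1$ right neighbors. A diagram is $k$-terminal if, for all $1\le j\le k$, there is no $j$-terminal chord before the $j$th-to-last chord in the order of sources. The connectivity $\kappa(C)$ is the vertex connectivity of the (undirected) intersection graph: the minimum number of vertices whose removal disconnects it, with the usual convention that a complete graph on $m$ vertices has connectivity $m-1$. $C$ is $k$-connected if $\kappa(C)\ge k$. -}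

module Defs where

open import Data.Nat.Base as ℕ using (ℕ; _*_; _∸_; _≤_)
import Data.Nat.Properties as ℕ
open import Data.Fin.Base using (Fin; toℕ; _<_)
open import Data.Fin.Properties using (_<?_; <-irrefl)
open import Data.Fin.Subset using (Subset; _∉_; ∣_∣)
open import Data.Product.Base using (_×_; _,_; ∃-syntax)
open import Data.Sum.Base using (_⊎_; inj₁; inj₂; [_,_]′; swap)
open import Data.Vec.Base using (tabulate)
open import Function.Definitions using (Bijective)
open import Level using (0ℓ)
open import Relation.Binary.Core using (Rel)
open import Relation.Binary.Definitions using (Decidable; Symmetric)
open import Relation.Binary.Construct.Closure.ReflexiveTransitive using (Star)
open import Relation.Binary.PropositionalEquality
  using (_≡_; _≢_; refl; sym; trans)
open import Relation.Nullary using (¬_; does; contradiction)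
open import Relation.Nullary.Decidable using (_×-dec_)

record Graph (n : ℕ) : Set₁ where
  field
    Adj        : Rel (Fin n) 0ℓ
    adj-sym    : Symmetric Adj
    adj-irrefl : ∀ v → ¬ Adj v v

module _ {n : ℕ} (G : Graph n) where
  open Graph G

  Complete : Set
  Complete = ∀ u v → u ≢ v → Adj u v

  -- Edges of the subgraph induced on the complement of S.
  AdjAvoiding : Subset n → Rel (Fin n) 0ℓ
  AdjAvoiding S u v = u ∉ S × v ∉ S × Adj u v

  -- Deleting S leaves two vertices that no walk joins.
  Disconnects : Subset n → Set
  Disconnects S =
    ∃[ u ] ∃[ v ] u ∉ S × v ∉ S × ¬ Star (AdjAvoiding S) u v

  IsMinimumCutSize : ℕ → Set
  IsMinimumCutSize m =
    (∃[ S ] Disconnects S × ∣ S ∣ ≡ m) × (∀ S → Disconnects S → m ≤ ∣ S ∣)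

  -- κ(G) = m, where κ is the vertex connectivity.
  IsConnectivity : ℕ → Set
  IsConnectivity m =
    (Complete × m ≡ n ∸ 1) ⊎ (¬ Complete × IsMinimumCutSize m)

  isConnectivity-unique : ∀ {m m′} → IsConnectivity m → IsConnectivity m′ → m ≡ m′
  isConnectivity-unique (inj₁ (_ , p)) (inj₁ (_ , q)) = trans p (sym q)
  isConnectivity-unique (inj₁ (c , _)) (inj₂ (¬c , _)) = contradiction c ¬c
  isConnectivity-unique (inj₂ (¬c , _)) (inj₁ (c , _)) = contradiction c ¬c
  isConnectivity-unique (inj₂ (_ , (S , dS , refl) , min)) (inj₂ (_ , (T , dT , refl) , min′)) =
    ℕ.≤-antisym (min T dT) (min′ S dS)

  -- κ(G) ≥ k; since κ is given as a relation, this includes that κ(G) exists.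
  ConnectivityAtLeast : ℕ → Set
  ConnectivityAtLeast k = ∃[ m ] IsConnectivity m × k ≤ m

-- A perfect matching of the 2n points 0, …, 2n-1, given by listing its n
-- chords (source i , sink i) in increasing order of sources.  Each matching has
-- exactly one such listing, so Fin n is the set of chords, ordered by sources.
-- Bijectivity says that every point is an endpoint of exactly one chord.
record ChordDiagram (n : ℕ) : Set where
  field
    source sink     : Fin n → Fin (2 * n)
    source<sink     : ∀ c → source c < sink c
    source-mono     : ∀ {c d} → c < d → source c < source d
    perfectMatching : Bijective _≡_ _≡_ [ source , sink ]′

module _ {n : ℕ} (C : ChordDiagram n) where
  open ChordDiagram C

  -- "RightNeighbor c d": d is a right neighbor of c.
  RightNeighbor : Rel (Fin n) 0ℓ
  RightNeighbor c d = source c < source d × source d < sink c × sink c < sink d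

  rightNeighbor? : Decidable RightNeighbor
  rightNeighbor? c d =
    source c <? source d ×-dec source d <? sink c ×-dec sink c <? sink d

  rightNeighbors : Fin n → Subset n
  rightNeighbors c = tabulate λ d → does (rightNeighbor? c d)

  intersectionGraph : Graph n
  intersectionGraph = record
    { Adj        = λ c d → RightNeighbor c d ⊎ RightNeighbor d c
    ; adj-sym    = swap
    ; adj-irrefl = λ { _ (inj₁ (p , _)) → <-irrefl refl p
                     ; _ (inj₂ (p , _)) → <-irrefl refl p }
    }

  -- Meant for j ≥ 1 only; ∸ truncates at j = 0.
  ChordTerminal : ℕ → Fin n → Set
  ChordTerminal j c = ∣ rightNeighbors c ∣ ≤ j ∸ 1

  -- d is the j-th-to-last chord; indices start at 0, so j = 1 is index n-1.
  JthToLast : ℕ → Fin n → Set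
  JthToLast j d = toℕ d ℕ.+ j ≡ n

  -- For j > n there is no j-th-to-last chord and the condition is vacuous.
  Terminal : ℕ → Set
  Terminal k = ∀ j → 1 ≤ j → j ≤ k → ∀ d → JthToLast j d →
    ¬ (∃[ c ] source c < source d × ChordTerminal j c)

  Connected : ℕ → Set
  Connected k = ConnectivityAtLeast intersectionGraph k

{-# OPTIONS --safe #-}
-- Let S be a set of fewer than k chords.  If c < d both avoid S, then some right
-- neighbor of c avoids S: otherwise the r right neighbors of c all lie in S, so
-- r < k, and together with d they are r + 1 chords after c, which makes c an
-- (r+1)-terminal chord before the (r+1)-th-to-last one.  Replacing the earlier of
-- two chords avoiding S by such a right neighbor, one eventually joins them.
-- That κ exists at all needs reachability in a finite graph to be decidable.
module Submission where

open import Data.Nat using (ℕ; _+_; _≤_)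
open import Defs

open import Data.Fin.Base as Fin using (Fin; toℕ; fromℕ<)
open import Data.Fin.Induction using (>-wellFounded)
import Data.Fin.Properties as Fin
open import Data.Fin.Subset
  using (Subset; inside; outside; _∈_; _∉_; _⊆_; ∣_∣; ∁; _∪_; ⁅_⁆)
open import Data.Fin.Subset.Properties
  using (_∈?_; anySubset?; ∣p∣≤n; p⊆q⇒∣p∣≤∣q∣; p⊂q⇒∣p∣<∣q∣; p⊆p∪q; q⊆p∪q;
         x∈p∪q⁻; x∈⁅x⁆; x∈⁅y⁆⇒x≡y; x∈p⇒x∉∁p; x∉∁p⇒x∈p)
open import Data.List.Base using (List; []; _∷_)
open import Data.List.Membership.Propositional using () renaming (_∈_ to _∈ₗ_)
open import Data.List.Membership.Propositional.Properties using (∈-allFin)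
open import Data.List.Relation.Unary.Any using (here; there)
open import Data.Nat using (suc; _∸_; _<_; z≤n; s≤s)
open import Data.Nat.Induction using (<-wellFounded)
import Data.Nat.Properties as ℕ
open import Data.Product using (_×_; _,_; proj₁; proj₂; ∃-syntax)
open import Data.Sum using (_⊎_; inj₁; inj₂; [_,_]′)
open import Data.Vec.Base using (_∷_; here; there)
open import Data.Vec.Properties using ([]=⇒lookup; lookup∘tabulate)
open import Function using (_∘_; id)
open import Induction.WellFounded using (Acc; acc)
open import Level using (Level)
open import Relation.Binary.Core using (Rel)
open import Relation.Binary.Definitions
  using (Decidable; DecidableEquality; tri<; tri≈; tri>)
open import Relation.Binary.Construct.Closure.ReflexiveTransitive
  using (Star; ε; _◅_; _◅◅_; reverse)
open import Relation.Binary.PropositionalEquality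
  using (_≡_; _≢_; refl; sym; trans; subst)
open import Relation.Nullary using (¬_; yes; no; contradiction)
open import Relation.Nullary.Decidable
  using (map′; ¬?; _×-dec_; _⊎-dec_; decidable-stable; dec-false; does)
import Relation.Unary as Unary

private variable
  a ℓ : Level
  n : ℕ

module Reachability {A : Set a} (_≟_ : DecidableEquality A)
                    {R : Rel A ℓ} (R? : Decidable R) where

  -- As in the Floyd–Warshall algorithm: walks whose inner vertices lie in the list.
  Via : List A → Rel A _
  Via []       u v = u ≡ v ⊎ R u v
  Via (p ∷ ps) u v = Via ps u v ⊎ (Via ps u p × Via ps p v)

  via? : ∀ ps → Decidable (Via ps)
  via? []       u v = (u ≟ v) ⊎-dec R? u v
  via? (p ∷ ps) u v = via? ps u v ⊎-dec (via? ps u p ×-dec via? ps p v)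

  via⇒star : ∀ ps {u v} → Via ps u v → Star R u v
  via⇒star []       (inj₁ refl)    = ε
  via⇒star []       (inj₂ r)       = r ◅ ε
  via⇒star (p ∷ ps) (inj₁ x)       = via⇒star ps x
  via⇒star (p ∷ ps) (inj₂ (x , y)) = via⇒star ps x ◅◅ via⇒star ps y

  via-base : ∀ ps {u v} → Via [] u v → Via ps u v
  via-base []       x = x
  via-base (p ∷ ps) x = inj₁ (via-base ps x)

  -- When `w` is the newest pivot, each half is cut at a visit to `w`, which discards any loop
  -- there. When both halves pass through a newer pivot `p`, the detour from `p` via `w` back to `p`
  -- is dropped.
  via-trans : ∀ {ps w u v} → w ∈ₗ ps → Via ps u w → Via ps w v → Via ps u v
  via-trans (here refl) x y = inj₂ ([ id , proj₁ ]′ x , [ id , proj₂ ]′ y)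
  via-trans (there w∈) (inj₁ x)       (inj₁ y)       = inj₁ (via-trans w∈ x y)
  via-trans (there w∈) (inj₁ x)       (inj₂ (y , z)) = inj₂ (via-trans w∈ x y , z)
  via-trans (there w∈) (inj₂ (x , y)) (inj₁ z)       = inj₂ (x , via-trans w∈ y z)
  via-trans (there w∈) (inj₂ (x , _)) (inj₂ (_ , z)) = inj₂ (x , z)

  module _ {ps : List A} (complete : ∀ w → w ∈ₗ ps) where

    -- With every vertex available as a pivot, an edge is prepended by composing at its far
    -- endpoint.
    star⇒via : ∀ {u v} → Star R u v → Via ps u v
    star⇒via ε        = via-base ps (inj₁ refl)
    star⇒via (r ◅ rs) = via-trans (complete _) (via-base ps (inj₂ r)) (star⇒via rs)

    star? : Decidable (Star R)
    star? u v = map′ (via⇒star ps) star⇒via (via? ps u v)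

least : {P : ℕ → Set ℓ} → Unary.Decidable P → ∀ {m} → P m →
        ∃[ l ] P l × (∀ {i} → P i → l ≤ i)
least {P = P} P? = go (<-wellFounded _)
  where
  go : ∀ {m} → Acc _<_ m → P m → ∃[ l ] P l × (∀ {i} → P i → l ≤ i)
  go {m} (acc rec) Pm with ℕ.anyUpTo? P? m
  ... | yes (i , i<m , Pi) = go (rec i<m) Pi
  ... | no  none           = m , Pm , λ Pi → ℕ.≮⇒≥ λ i<m → none (_ , i<m , Pi)

-- Only `n ∸ suc (toℕ c)` indices come after `c`; the additive form avoids truncated subtraction.
∣p∣≤-above : (p : Subset n) (c : Fin n) → (∀ {d} → d ∈ p → c Fin.< d) →
             ∣ p ∣ + suc (toℕ c) ≤ n
∣p∣≤-above (inside  ∷ p) c           above = contradiction (above here) λ ()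
∣p∣≤-above (outside ∷ p) Fin.zero    above
  rewrite ℕ.+-comm ∣ p ∣ 1 = s≤s (∣p∣≤n p)
∣p∣≤-above (outside ∷ p) (Fin.suc c) above
  rewrite ℕ.+-suc ∣ p ∣ (suc (toℕ c)) =
  s≤s (∣p∣≤-above p c (ℕ.≤-pred ∘ above ∘ there))

module _ (G : Graph n) where
  open Graph G

  -- Only `u` and `v` survive the deletion, so the first edge of a walk from `u` would be a loop or
  -- the missing edge. Hence an incomplete graph has a cut, from which the search for a minimum one
  -- can start.
  nonadjacent⇒disconnects : ∀ {u v} → u ≢ v → ¬ Adj u v →
                            Disconnects G (∁ (⁅ u ⁆ ∪ ⁅ v ⁆))
  nonadjacent⇒disconnects {u} {v} u≢v ¬uv =
    u , v , x∈p⇒x∉∁p (p⊆p∪q ⁅ v ⁆ (x∈⁅x⁆ u)) , x∈p⇒x∉∁p (q⊆p∪q ⁅ u ⁆ ⁅ v ⁆ (x∈⁅x⁆ v)) , no-walk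
    where
    no-walk : ¬ Star (AdjAvoiding G (∁ (⁅ u ⁆ ∪ ⁅ v ⁆))) u v
    no-walk ε = u≢v refl
    no-walk ((_ , w∉ , uw) ◅ _) with x∈p∪q⁻ ⁅ u ⁆ ⁅ v ⁆ (x∉∁p⇒x∈p w∉)
    ... | inj₁ w∈u = adj-irrefl u (subst (Adj u) (x∈⁅y⁆⇒x≡y _ w∈u) uw)
    ... | inj₂ w∈v = ¬uv (subst (Adj u) (x∈⁅y⁆⇒x≡y _ w∈v) uw)

  module _ (adj? : Decidable Adj) where

    adjAvoiding? : ∀ S → Decidable (AdjAvoiding G S)
    adjAvoiding? S u v = ¬? (u ∈? S) ×-dec ¬? (v ∈? S) ×-dec adj? u v

    disconnects? : Unary.Decidable (Disconnects G)
    disconnects? S = Fin.any? λ u → Fin.any? λ v →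
      ¬? (u ∈? S) ×-dec ¬? (v ∈? S) ×-dec ¬? (star? ∈-allFin u v)
      where open Reachability Fin._≟_ (adjAvoiding? S)

    disconnects⇒minimumCutSize : ∀ {S} → Disconnects G S → ∃[ m ] IsMinimumCutSize G m
    disconnects⇒minimumCutSize {S} dS =
      -- Minimality is taken over sizes: whether some cut has size `m` is decidable, since there are
      -- finitely many subsets.
      let m , cut , min = least (λ m → anySubset? λ T → disconnects? T ×-dec (∣ T ∣ ℕ.≟ m))
                                (S , dS , refl)
      in m , cut , λ T dT → min (T , dT , refl)

    -- The two hypotheses serve the two cases of κ: `k + 1 ≤ n` bounds the conventional value
    -- `n ∸ 1` of a complete graph, and the bound on all cuts applies to a minimum one otherwise.
    connectivityAtLeast : ∀ {k} → k + 1 ≤ n → (∀ S → Disconnects G S → k ≤ ∣ S ∣) →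
                          ConnectivityAtLeast G k
    connectivityAtLeast {k} k<n large
      with Fin.any? (λ u → Fin.any? λ v → ¬? (u Fin.≟ v) ×-dec ¬? (adj? u v))
    ... | no none = n ∸ 1 , inj₁ (complete , refl) , ℕ.m+n≤o⇒m≤o∸n k k<n
      where
      complete : Complete G
      complete u v u≢v = decidable-stable (adj? u v) λ ¬uv → none (u , v , u≢v , ¬uv)
    ... | yes (u , v , u≢v , ¬uv) =
      let m , (S , dS , ∣S∣≡m) , min = disconnects⇒minimumCutSize (nonadjacent⇒disconnects u≢v ¬uv)
      in m , inj₂ ((λ complete → ¬uv (complete u v u≢v)) , (S , dS , ∣S∣≡m) , min)
           , subst (k ≤_) ∣S∣≡m (large S dS)

module _ (C : ChordDiagram n) where
  open ChordDiagram C
  open Graph (intersectionGraph C)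

  crossing? : Decidable Adj
  crossing? c d = rightNeighbor? C c d ⊎-dec rightNeighbor? C d c

  source-cancel : ∀ {c d} → source c Fin.< source d → c Fin.< d
  source-cancel {c} {d} sc<sd with Fin.<-cmp c d
  ... | tri< c<d _ _  = c<d
  ... | tri≈ _ refl _ = contradiction sc<sd (Fin.<-irrefl refl)
  ... | tri> _ _ d<c  = contradiction (source-mono d<c) (Fin.<-asym sc<sd)

  ∈-rightNeighbors⁻ : ∀ {c d} → d ∈ rightNeighbors C c → RightNeighbor C c d
  ∈-rightNeighbors⁻ {c} {d} d∈ = decidable-stable (rightNeighbor? C c d) λ ¬cd →
    contradiction (trans (sym (dec-false (rightNeighbor? C c d) ¬cd)) cd-true) λ ()
    where
    cd-true = trans (sym (lookup∘tabulate (λ e → does (rightNeighbor? C c e)) d))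
                    ([]=⇒lookup d∈)

  module _ {k} (terminal : Terminal C k) {S : Subset n} (∣S∣<k : ∣ S ∣ < k) where

    rightNeighbors⊈ : ∀ {c d} → c Fin.< d → d ∉ S → ¬ rightNeighbors C c ⊆ S
    rightNeighbors⊈ {c} {d} c<d d∉S N⊆S =
      -- Here `j` is `suc r`, so that `ChordTerminal j c` reduces to `r ≤ r`, and `j ≤ k` follows
      -- from `r ≤ ∣ S ∣ < k`.
      terminal (suc r) (s≤s z≤n) (ℕ.≤-<-trans (p⊆q⇒∣p∣≤∣q∣ N⊆S) ∣S∣<k)
        e (trans (ℕ.+-comm (toℕ e) (suc r)) r+1+e≡n)
        (c , source-mono c<e , ℕ.≤-refl)
      where
      N = rightNeighbors C c
      r = ∣ N ∣

      above : ∀ {x} → x ∈ N ∪ ⁅ d ⁆ → c Fin.< x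
      above x∈ with x∈p∪q⁻ N ⁅ d ⁆ x∈
      ... | inj₁ x∈N = source-cancel (proj₁ (∈-rightNeighbors⁻ x∈N))
      ... | inj₂ x∈d = subst (c Fin.<_) (sym (x∈⁅y⁆⇒x≡y _ x∈d)) c<d

      -- `d` is not in `N`, because `N` lies in `S` and `d` does not.
      r<∣N∪d∣ : r < ∣ N ∪ ⁅ d ⁆ ∣
      r<∣N∪d∣ = p⊂q⇒∣p∣<∣q∣
        (p⊆p∪q ⁅ d ⁆ , d , q⊆p∪q N ⁅ d ⁆ (x∈⁅x⁆ d) , d∉S ∘ N⊆S)

      r+1+c<n : suc r + suc (toℕ c) ≤ n
      r+1+c<n = ℕ.≤-trans (ℕ.+-monoˡ-≤ (suc (toℕ c)) r<∣N∪d∣) (∣p∣≤-above (N ∪ ⁅ d ⁆) c above)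

      r<n : suc r ≤ n
      r<n = ℕ.m+n≤o⇒m≤o (suc r) r+1+c<n

      e<n : n ∸ suc r < n
      e<n = ℕ.∸-monoʳ-< (s≤s z≤n) r<n

      -- Index `n ∸ suc r` is the `suc r`-th-to-last chord. It need not lie in `N ∪ ⁅ d ⁆`; counting
      -- alone places it after `c`.
      e : Fin n
      e = fromℕ< e<n

      r+1+e≡n : suc r + toℕ e ≡ n
      r+1+e≡n rewrite Fin.toℕ-fromℕ< e<n = ℕ.m+[n∸m]≡n r<n

      c<e : c Fin.< e
      c<e = ℕ.+-cancelˡ-≤ (suc r) _ _ (subst (suc r + suc (toℕ c) ≤_) (sym r+1+e≡n) r+1+c<n)

    rightNeighborAvoiding : ∀ {c d} → c Fin.< d → d ∉ S →
                            ∃[ e ] e ∉ S × RightNeighbor C c e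
    rightNeighborAvoiding {c} c<d d∉S
      with Fin.any? (λ e → ¬? (e ∈? S) ×-dec (e ∈? rightNeighbors C c))
    ... | yes (e , e∉S , e∈N) = e , e∉S , ∈-rightNeighbors⁻ e∈N
    ... | no none = contradiction
      (λ {e} e∈N → decidable-stable (e ∈? S) λ e∉S → none (e , e∉S , e∈N))
      (rightNeighbors⊈ c<d d∉S)

    Joined : Rel (Fin n) _
    Joined = Star (AdjAvoiding (intersectionGraph C) S)

    joined-sym : ∀ {u v} → Joined u v → Joined v u
    joined-sym = reverse λ (u∉ , v∉ , uv) → v∉ , u∉ , adj-sym uv

    -- The induction terminates because the earlier of the two chords strictly advances at every
    -- step.
    joined-< : ∀ {u v} → u ∉ S → v ∉ S → u Fin.< v → Joined u v
    joined-< = go (>-wellFounded _)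
      where
      go : ∀ {u v} → Acc Fin._>_ u → u ∉ S → v ∉ S → u Fin.< v → Joined u v
      go {u} {v} (acc rec) u∉ v∉ u<v with rightNeighborAvoiding u<v v∉
      ... | w , w∉ , uw with Fin.<-cmp w v
      ...   | tri< w<v _ _  =
        (u∉ , w∉ , inj₁ uw) ◅ go (rec (source-cancel (proj₁ uw))) w∉ v∉ w<v
      ...   | tri≈ _ refl _ = (u∉ , w∉ , inj₁ uw) ◅ ε
      -- The neighbor overshoots `v`, so `v` becomes the earlier chord and the walk found from `v`
      -- to `w` is reversed.
      ...   | tri> _ _ v<w  = (u∉ , w∉ , inj₁ uw) ◅ joined-sym (go (rec u<v) v∉ w∉ v<w)

    joined : ∀ {u v} → u ∉ S → v ∉ S → Joined u v
    joined {u} {v} u∉ v∉ with Fin.<-cmp u v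
    ... | tri< u<v _ _  = joined-< u∉ v∉ u<v
    ... | tri≈ _ refl _ = ε
    ... | tri> _ _ v<u  = joined-sym (joined-< v∉ u∉ v<u)

proposition8p7 : (k : ℕ) → 1 ≤ k → (n : ℕ) (C : ChordDiagram n) →
    Terminal C k → k + 1 ≤ n → Connected C k
proposition8p7 k _ n C terminal k<n =
  connectivityAtLeast (intersectionGraph C) (crossing? C) k<n
    λ { S (u , v , u∉ , v∉ , ¬uv) → ℕ.≮⇒≥ λ ∣S∣<k → ¬uv (joined C terminal ∣S∣<k u∉ v∉) }
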